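{- Let $\Gamma=(G,\sigma)$ be a signed graph. The following are equivalent: (1) $\Gamma$ is sign-symmetric; (2) $\Gamma$ has a weak automorphism; (3) there exists $\varphi\in Aut(G)$ such that $\varphi(\mathcal{C}_1^+)=\mathcal{C}_1^-$ and $\varphi(\mathcal{C}_0^+)=\mathcal{C}_0^+$.
   Context: Graphs are finite and simple. A signed graph $\Gamma=(G,\sigma)$ consists of a connected simple graph $G$ and a function $\sigma:E(G)\to\{+1,-1\}$. Switching $\Gamma$ with respect to $U\subseteq V(G)$ means reversing the signs of all edges between $U$ and $V(G)\setminus U$. Two signed graphs are isomorphic if there is an isomorphism of the underlying graphs preserving edge signs; $\Gamma$ and $\Gamma'$ are switching isomorphic ($\Gamma\simeq\Gamma'$) if $\Gamma$ is isomorphic to a switching of $\Gamma'$. $-\Gamma=(G,-\sigma)$. $\Gamma$ is sign-symmetric if $\Gamma\simeq-\Gamma$. The sign of a cycle $C$ is $\sigma(C)=\prod_{e\in E(C)}\sigma(e)$. $\mathcal{C}_0$ (resp. $\mathcal{C}_1$) is the set of cycles of $G$ of even (resp. odd) length, and $\mathcal{C}_i^{+}$ (resp. $\mathcal{C}_i^-$) is the set of $C\in\mathcal{C}_i$ with $\sigma(C)=1$ (resp. $\sigma(C)=-1$). $Aut(G)$ is the automorphism group of the (unsigned) graph $G$, acting on cycles of $G$. A weak automorphism of $\Gamma$ is a $\varphi\in Aut(G)$ with $\sigma(\varphi(C))=-\sigma(C)$ for every $C\in\mathcal{C}_1$ and $\sigma(\varphi(C))=\sigma(C)$ for every $C\in\mathcal{C}_0$.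 -}

module Defs where

open import Data.Bool.Base using (Bool; _xor_; if_then_else_)
open import Data.Bool.Properties using (xor-comm)
open import Data.Fin.Base using (Fin)
open import Data.Fin.Permutation using (Permutation; _⟨$⟩ʳ_)
open import Data.Fin.Subset using (Subset)
open import Data.List.Base as List using (List; []; _∷_; length)
open import Data.List.Membership.Propositional using (_∈_)
open import Data.List.Properties using (length-map; map-∘)
open import Data.List.Relation.Unary.Unique.Propositional using (Unique)
open import Data.List.Relation.Unary.Unique.Propositional.Properties using (map⁺)
open import Data.Nat.Base using (ℕ; _≤_; parity)
open import Data.Parity.Base using (Parity; 0ℙ; 1ℙ)
open import Data.Product.Base as Product using (∃-syntax; _×_; _,_; proj₁)
open import Data.Sign.Base using (Sign; +; -; opposite; _*_)
open import Data.Sum.Base using (_⊎_)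
open import Data.Vec.Base using (lookup)
open import Function.Bundles using (_⇔_; Injection)
open import Function.Properties.Inverse using (↔⇒↣)
open import Level using (0ℓ)
open import Relation.Binary.Construct.Closure.ReflexiveTransitive using (Star; ε; _◅_; gmap)
open import Relation.Binary.Core using (Rel)
open import Relation.Binary.Definitions using (Decidable; Irrelevant; Irreflexive; Symmetric)
open import Relation.Binary.PropositionalEquality using (_≡_; refl; sym; trans; cong; cong₂; subst)
open import Relation.Unary using (Pred)

------------------------------------------------------------------------
-- Graphs

-- `adj-irrelevant` rules out parallel edges: a signature assigns signs to
-- proofs of adjacency, and there is at most one such proof per vertex pair.
record Graph : Set₁ where
  field
    order          : ℕ
  V : Set
  V = Fin order
  field
    Adj            : Rel V 0ℓ
    adj?           : Decidable Adj
    adj-irrelevant : Irrelevant Adj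
    adj-irrefl     : Irreflexive _≡_ Adj
    adj-sym        : Symmetric Adj

  Walk : Rel V 0ℓ
  Walk = Star Adj

  Connected : Set
  Connected = ∀ u v → Walk u v

  -- The oriented edges traversed by a walk, in order.
  steps : ∀ {u v} → Walk u v → List (V × V)
  steps ε                 = []
  steps (_◅_ {u} {v} _ w) = (u , v) ∷ steps w

  -- A cycle is presented by a traversal: a closed walk with at least three
  -- steps whose steps start at pairwise distinct vertices. Such a walk
  -- traverses each edge of the cycle exactly once.
  record Cycle : Set where
    field
      base     : V
      walk     : Walk base base
      long     : 3 ≤ length (steps walk)
      distinct : Unique (List.map proj₁ (steps walk))

  open Cycle public

  len : Cycle → ℕ
  len C = length (steps (walk C))

  HasEdge : Cycle → V → V → Set
  HasEdge C u v = (u , v) ∈ steps (walk C) ⊎ (v , u) ∈ steps (walk C)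

  -- Different traversals of one cycle (other starting vertex or direction)
  -- are identified: cycles are equal as subgraphs when they have the same edges.
  infix 4 _≈ᶜ_
  _≈ᶜ_ : Rel Cycle 0ℓ
  C ≈ᶜ D = ∀ u v → HasEdge C u v ⇔ HasEdge D u v

record Iso (G H : Graph) : Set where
  private
    module G = Graph G
    module H = Graph H
  field
    perm : Permutation G.order H.order

  fun : G.V → H.V
  fun = perm ⟨$⟩ʳ_

  field
    preserves : ∀ {u v} → G.Adj u v → H.Adj (fun u) (fun v)
    reflects  : ∀ {u v} → H.Adj (fun u) (fun v) → G.Adj u v

Aut : Graph → Set
Aut G = Iso G G

module _ {G : Graph} (φ : Aut G) where
  open Graph G
  open Iso φ

  private
    mapWalk : ∀ {u v} → Walk u v → Walk (fun u) (fun v)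
    mapWalk = gmap fun preserves

    steps-map : ∀ {u v} (w : Walk u v) →
                steps (mapWalk w) ≡ List.map (Product.map fun fun) (steps w)
    steps-map ε       = refl
    steps-map (_ ◅ w) = cong (_ ∷_) (steps-map w)

    length-steps : ∀ {u v} (w : Walk u v) →
                   length (steps (mapWalk w)) ≡ length (steps w)
    length-steps w = trans (cong length (steps-map w)) (length-map _ (steps w))

    starts-map : ∀ {u v} (w : Walk u v) →
                 List.map proj₁ (steps (mapWalk w)) ≡ List.map fun (List.map proj₁ (steps w))
    starts-map w = trans (cong (List.map proj₁) (steps-map w))
                  (trans (sym (map-∘ (steps w))) (map-∘ (steps w)))

  mapCycle : Cycle → Cycle
  mapCycle C = record
    { base     = fun (base C)
    ; walk     = mapWalk (walk C)
    ; long     = subst (3 ≤_) (sym (length-steps (walk C))) (long C)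
    ; distinct = subst Unique (sym (starts-map (walk C)))
                   (map⁺ (Injection.injective (↔⇒↣ perm)) (distinct C))
    }

  image : Pred Cycle 0ℓ → Pred Cycle 0ℓ
  image S C = ∃[ D ] S D × mapCycle D ≈ᶜ C

------------------------------------------------------------------------
-- Signed graphs

record SignedGraph : Set₁ where
  field
    graph     : Graph
  open Graph graph
  field
    connected : Connected
    σ         : ∀ {u v} → Adj u v → Sign
    σ-sym     : ∀ {u v} (e : Adj u v) → σ (adj-sym e) ≡ σ e

  walkSign : ∀ {u v} → Walk u v → Sign
  walkSign ε       = +
  walkSign (e ◅ w) = σ e * walkSign w

  cycleSign : Cycle → Sign
  cycleSign C = walkSign (walk C)

  𝒞 : Parity → Pred Cycle 0ℓ
  𝒞 i C = parity (len C) ≡ i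

  𝒞± : Parity → Sign → Pred Cycle 0ℓ
  𝒞± i s C = 𝒞 i C × cycleSign C ≡ s

  𝒞₀ 𝒞₁ 𝒞₀⁺ 𝒞₁⁺ 𝒞₁⁻ : Pred Cycle 0ℓ
  𝒞₀  = 𝒞 0ℙ
  𝒞₁  = 𝒞 1ℙ
  𝒞₀⁺ = 𝒞± 0ℙ +
  𝒞₁⁺ = 𝒞± 1ℙ +
  𝒞₁⁻ = 𝒞± 1ℙ -

switch : (Γ : SignedGraph) → Subset (Graph.order (SignedGraph.graph Γ)) → SignedGraph
switch Γ U = record
  { graph     = graph
  ; connected = connected
  ; σ         = λ {u} {v} e → if crosses u v then opposite (σ e) else σ e
  ; σ-sym     = λ {u} {v} e →
      cong₂ (λ b s → if b then opposite s else s)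
            (xor-comm (lookup U v) (lookup U u)) (σ-sym e)
  }
  where
  open SignedGraph Γ
  open Graph graph
  crosses : V → V → Bool
  crosses u v = lookup U u xor lookup U v

negate : SignedGraph → SignedGraph
negate Γ = record
  { graph     = graph
  ; connected = connected
  ; σ         = λ e → opposite (σ e)
  ; σ-sym     = λ e → cong opposite (σ-sym e)
  }
  where open SignedGraph Γ

record SignedIso (Γ Δ : SignedGraph) : Set where
  private
    module Γ = SignedGraph Γ
    module Δ = SignedGraph Δ
  field
    iso : Iso Γ.graph Δ.graph
  open Iso iso
  field
    preserves-σ : ∀ {u v} (e : Graph.Adj Γ.graph u v) → Δ.σ (preserves e) ≡ Γ.σ e

infix 4 _≃_
_≃_ : SignedGraph → SignedGraph → Set
Γ ≃ Δ = ∃[ U ] SignedIso Γ (switch Δ U)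

SignSymmetric : SignedGraph → Set
SignSymmetric Γ = Γ ≃ negate Γ

IsWeakAutomorphism : (Γ : SignedGraph) → Aut (SignedGraph.graph Γ) → Set
IsWeakAutomorphism Γ φ =
  (∀ C → 𝒞₁ C → cycleSign (mapCycle φ C) ≡ opposite (cycleSign C)) ×
  (∀ C → 𝒞₀ C → cycleSign (mapCycle φ C) ≡ cycleSign C)
  where open SignedGraph Γ

{-# OPTIONS --safe #-}
module Submission where

-- Twist σ by an automorphism φ to the signature τ e = − σ e σ (φ e). A walk w then has
-- τ w = (−1)^|w| σ w σ (φ w), so φ is a weak automorphism exactly when every cycle is
-- τ-positive. By Harary's balance theorem this means that τ e = s u s v for a potential s,
-- and then switching −σ at the φ-image of the negative set of s makes φ an isomorphism.
-- The passage to images of cycle classes needs that the sign and length of a cycle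
-- depend only on its edge set, and that φ is injective on edge sets.

open import Defs
open import Algebra.Properties.CommutativeSemigroup using (interchange)
open import Data.Bool.Base using (Bool; true; false; _xor_; if_then_else_)
open import Data.Fin.Base using (Fin; zero; suc)
open import Data.Fin.Permutation as Perm using (_⟨$⟩ˡ_; inverseˡ; inverseʳ)
open import Data.Fin.Properties using (_≟_; _≤?_; ≤-antisym; ≤-total)
open import Data.Fin.Subset using (Subset)
open import Data.List.Base as List using (List; []; _∷_; length; foldr)
open import Data.List.Membership.Propositional using (_∈_; _∉_)
open import Data.List.Membership.Propositional.Properties using (∈-map⁺; ∈-map⁻)
open import Data.List.Membership.Propositional.Properties.WithK using (unique∧set⇒bag)
open import Data.List.Properties using (length-map; map-∘; map-id; map-cong)
open import Data.List.Relation.Binary.BagAndSetEquality using (∼bag⇒↭)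
open import Data.List.Relation.Binary.Permutation.Propositional using (_↭_; ↭⇒↭ₛ)
open import Data.List.Relation.Binary.Permutation.Propositional.Properties using (↭-length)
  renaming (map⁺ to ↭-map⁺)
open import Data.List.Relation.Binary.Permutation.Setoid.Properties using (foldr-commMonoid)
open import Data.List.Relation.Unary.All as All using (All; []; _∷_)
open import Data.List.Relation.Unary.All.Properties using (¬Any⇒All¬)
import Data.List.Relation.Unary.All.Properties as All
open import Data.List.Relation.Unary.AllPairs using ([]; _∷_)
open import Data.List.Relation.Unary.Any using (here; there; any?)
open import Data.List.Relation.Unary.Unique.Propositional using (Unique)
open import Data.List.Relation.Unary.Unique.Propositional.Properties using (map⁻)
open import Data.Nat.Base using (ℕ; suc; _≤_; s≤s; z≤n; parity)
open import Data.Parity.Base using (0ℙ; 1ℙ; toSign)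
open import Data.Parity.Properties using (suc-homo-⁻¹; ⁻¹-selfInverse; ⁻¹-homo-opposite)
open import Data.Product.Base as Product using (Σ; ∃; _×_; _,_; proj₁; proj₂; swap)
open import Data.Product.Function.Dependent.Propositional using (Σ-⇔)
open import Data.Product.Function.NonDependent.Propositional using (_×-⇔_)
open import Data.Sign.Base using (Sign; +; -; opposite; _*_)
open import Data.Sign.Properties
  using (s*s≡+; *-assoc; *-comm; *-identityʳ; *-cancelˡ-≡; *-cancelʳ-≡; opposite[s]*s≡-;
         *-commutativeSemigroup; *-isCommutativeMonoid)
open import Data.Sum.Base as Sum using (_⊎_; inj₁; inj₂)
open import Data.Vec.Base using (lookup; tabulate)
open import Data.Vec.Properties using (lookup∘tabulate)
open import Function.Base using (_∘_; id)
open import Function.Bundles using (_⇔_; mk⇔; Equivalence; Injection)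
open import Function.Construct.Composition using (_⇔-∘_)
open import Function.Construct.Identity using (↠-id)
open import Function.Construct.Symmetry using (⇔-sym)
open import Function.Properties.Inverse using (↔⇒↣)
open import Relation.Binary.Construct.Closure.ReflexiveTransitive using (ε; _◅_; _◅◅_; gmap)
open import Relation.Binary.PropositionalEquality
open import Relation.Nullary using (¬_; yes; no; contradiction)
open import Relation.Unary using (_≐_; _⊆_)
open ≡-Reasoning

-- Lists without repetition

-- Injectivity is asked for on members of the list only: `sortPair` is injective on the steps of a
-- cycle, but not on all pairs in general.
unique-map : ∀ {A B : Set} (f : A → B) {xs : List A} →
             (∀ {x y} → x ∈ xs → y ∈ xs → f x ≡ f y → x ≡ y) →
             Unique xs → Unique (List.map f xs)
unique-map f inj []          = []
unique-map f inj (x∉ ∷ xs!) =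
  All.map⁺ (All.tabulate λ y∈ fx≡fy → All.lookup x∉ y∈ (inj (here refl) (there y∈) fx≡fy)) ∷
  unique-map f (λ x∈ y∈ → inj (there x∈) (there y∈)) xs!

-- Applied to `proj₁` and the steps of a cycle, this makes the successor of each vertex unique.
unique-map⇒injective : ∀ {A B : Set} (f : A → B) {xs : List A} → Unique (List.map f xs) →
                       ∀ {x y} → x ∈ xs → y ∈ xs → f x ≡ f y → x ≡ y
unique-map⇒injective f _          (here refl) (here refl) _  = refl
unique-map⇒injective f (x∉ ∷ _)   (here refl) (there y∈)  eq = contradiction eq (All.lookup x∉ (∈-map⁺ f y∈))
unique-map⇒injective f (x∉ ∷ _)   (there x∈)  (here refl) eq = contradiction (sym eq) (All.lookup x∉ (∈-map⁺ f x∈))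
unique-map⇒injective f (_ ∷ xs!)  (there x∈)  (there y∈)  eq = unique-map⇒injective f xs! x∈ y∈ eq

¬three-in-pair : ∀ {A : Set} {u v a b c : A} {xs : List A} →
                 All (λ x → x ≡ u ⊎ x ≡ v) (a ∷ b ∷ c ∷ xs) → ¬ Unique (a ∷ b ∷ c ∷ xs)
¬three-in-pair (inj₁ refl ∷ inj₁ refl ∷ _)             ((a≢b ∷ _) ∷ _)     = a≢b refl
¬three-in-pair (inj₁ refl ∷ inj₂ refl ∷ inj₁ refl ∷ _) ((_ ∷ a≢c ∷ _) ∷ _) = a≢c refl
¬three-in-pair (inj₁ refl ∷ inj₂ refl ∷ inj₂ refl ∷ _) (_ ∷ (b≢c ∷ _) ∷ _) = b≢c refl
¬three-in-pair (inj₂ refl ∷ inj₂ refl ∷ _)             ((a≢b ∷ _) ∷ _)     = a≢b refl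
¬three-in-pair (inj₂ refl ∷ inj₁ refl ∷ inj₂ refl ∷ _) ((_ ∷ a≢c ∷ _) ∷ _) = a≢c refl
¬three-in-pair (inj₂ refl ∷ inj₁ refl ∷ inj₁ refl ∷ _) (_ ∷ (b≢c ∷ _) ∷ _) = b≢c refl

-- Unordered pairs of vertices

module _ {n : ℕ} where

  -- A normal form for unordered pairs, so that both directions of an edge give the same entry.
  sortPair : Fin n × Fin n → Fin n × Fin n
  sortPair (u , v) with u ≤? v
  ... | yes _ = u , v
  ... | no _  = v , u

  sortPair-swap : ∀ u v → sortPair (u , v) ≡ sortPair (v , u)
  sortPair-swap u v with u ≤? v | v ≤? u
  ... | yes u≤v | yes v≤u with refl ← ≤-antisym u≤v v≤u = refl
  ... | yes _   | no _    = refl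
  ... | no _    | yes _   = refl
  ... | no u≰v  | no v≰u  = contradiction (≤-total u v) Sum.[ u≰v , v≰u ]

  sortPair-either : ∀ p → sortPair p ≡ p ⊎ sortPair p ≡ swap p
  sortPair-either (u , v) with u ≤? v
  ... | yes _ = inj₁ refl
  ... | no _  = inj₂ refl

  sortPair-≡ : ∀ p q → sortPair p ≡ sortPair q → p ≡ q ⊎ p ≡ swap q
  sortPair-≡ p q eq with sortPair-either p | sortPair-either q
  ... | inj₁ p′ | inj₁ q′ = inj₁ (trans (sym p′) (trans eq q′))
  ... | inj₁ p′ | inj₂ q′ = inj₂ (trans (sym p′) (trans eq q′))
  ... | inj₂ p′ | inj₁ q′ = inj₂ (cong swap (trans (sym p′) (trans eq q′)))
  ... | inj₂ p′ | inj₂ q′ = inj₁ (cong swap (trans (sym p′) (trans eq q′)))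

-- Cycles as edge sets

module _ (G : Graph) where
  open Graph G

  starts : ∀ {u v} → Walk u v → List V
  starts w = List.map proj₁ (steps w)

  module _ {P : V → Set} where

    walk-closed : ∀ {u v} (w : Walk u v) → (∀ {x y} → (x , y) ∈ steps w → P x → P y) →
                  P u → P v × All P (starts w)
    walk-closed ε       _  Pu = Pu , []
    walk-closed (_ ◅ w) cl Pu with Pv , Ps ← walk-closed w (cl ∘ there) (cl (here refl) Pu) = Pv , Pu ∷ Ps

    -- On a closed walk `v` is also the base. One step starting in `P` thus puts the base in `P`,
    -- and `walk-closed` then reaches every vertex.
    walk-closed-end : ∀ {u v} (w : Walk u v) → (∀ {x y} → (x , y) ∈ steps w → P x → P y) →
                      ∀ {x y} → (x , y) ∈ steps w → P x → P v
    walk-closed-end w@(_ ◅ _) cl (here refl) Px = proj₁ (walk-closed w cl Px)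
    walk-closed-end (_ ◅ w)   cl (there xy∈) Px = walk-closed-end w (cl ∘ there) xy∈ Px

  -- If both (u , v) and (v , u) were steps, the set {u , v} would be closed under
  -- successors, hence contain all the vertices of the cycle.
  cycle-no-reversal : (C : Cycle) → ∀ {u v} → (u , v) ∈ steps (walk C) → (v , u) ∉ steps (walk C)
  cycle-no-reversal C {u} {v} uv∈ vu∈ =
    absurd (walk C) (long C) (proj₂ (walk-closed (walk C) closed base∈)) (distinct C)
    where
    P : V → Set
    P x = x ≡ u ⊎ x ≡ v

    closed : ∀ {x y} → (x , y) ∈ steps (walk C) → P x → P y
    closed xy∈ (inj₁ x≡u) = inj₂ (cong proj₂ (unique-map⇒injective proj₁ (distinct C) xy∈ uv∈ x≡u))
    closed xy∈ (inj₂ x≡v) = inj₁ (cong proj₂ (unique-map⇒injective proj₁ (distinct C) xy∈ vu∈ x≡v))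

    base∈ : P (base C)
    base∈ = walk-closed-end (walk C) closed uv∈ (inj₁ refl)

    absurd : ∀ {a b} (w : Walk a b) → 3 ≤ length (steps w) → All P (starts w) → ¬ Unique (starts w)
    absurd (_ ◅ _ ◅ _ ◅ _) _ = ¬three-in-pair
    absurd ε               ()
    absurd (_ ◅ ε)         (s≤s ())
    absurd (_ ◅ _ ◅ ε)     (s≤s (s≤s ()))

  edges : Cycle → List (V × V)
  edges C = List.map sortPair (steps (walk C))

  -- Steps with the same sorted pair are equal or mutually reversed, and `cycle-no-reversal`
  -- excludes the latter.
  edges-unique : (C : Cycle) → Unique (edges C)
  edges-unique C = unique-map sortPair inj (map⁻ (distinct C))
    where
    inj : ∀ {p q} → p ∈ steps (walk C) → q ∈ steps (walk C) → sortPair p ≡ sortPair q → p ≡ q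
    inj {p} {q} p∈ q∈ eq with sortPair-≡ p q eq
    ... | inj₁ p≡q  = p≡q
    ... | inj₂ refl = contradiction p∈ (cycle-no-reversal C q∈)

  ≈ᶜ-sym : ∀ {C D} → C ≈ᶜ D → D ≈ᶜ C
  ≈ᶜ-sym C≈D u v = ⇔-sym (C≈D u v)

  edges-⊆ : ∀ C D → C ≈ᶜ D → ∀ {p} → p ∈ edges C → p ∈ edges D
  edges-⊆ C D C≈D p∈ with (u , v) , uv∈ , refl ← ∈-map⁻ sortPair p∈
    with Equivalence.to (C≈D u v) (inj₁ uv∈)
  ... | inj₁ uv∈′ = ∈-map⁺ sortPair uv∈′
  ... | inj₂ vu∈′ = subst (_∈ edges D) (sortPair-swap v u) (∈-map⁺ sortPair vu∈′)

  -- Duplicate-free lists with the same members are permutations of each other; lengths and products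
  -- of signs can then be compared.
  edges-↭ : ∀ C D → C ≈ᶜ D → edges C ↭ edges D
  edges-↭ C D C≈D = ∼bag⇒↭ (unique∧set⇒bag (edges-unique C) (edges-unique D)
    (mk⇔ (edges-⊆ C D C≈D) (edges-⊆ D C (≈ᶜ-sym {C} {D} C≈D))))

  len-resp-≈ᶜ : ∀ C D → C ≈ᶜ D → len C ≡ len D
  len-resp-≈ᶜ C D C≈D = begin
    len C             ≡⟨ length-map sortPair (steps (walk C)) ⟨
    length (edges C)  ≡⟨ ↭-length (edges-↭ C D C≈D) ⟩
    length (edges D)  ≡⟨ length-map sortPair (steps (walk D)) ⟩
    len D             ∎

-- The sign of a cycle as a product over its edge set

module _ (Γ : SignedGraph) where
  open SignedGraph Γ
  open Graph graph

  -- Junk value + on non-adjacent pairs.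
  σ² : V × V → Sign
  σ² (u , v) with adj? u v
  ... | yes e = σ e
  ... | no _  = +

  σ²-Adj : ∀ {u v} (e : Adj u v) → σ² (u , v) ≡ σ e
  σ²-Adj {u} {v} e with adj? u v
  ... | yes e′ = cong σ (adj-irrelevant e′ e)
  ... | no ¬e  = contradiction e ¬e

  σ²-sortPair : ∀ {u v} (e : Adj u v) → σ² (sortPair (u , v)) ≡ σ e
  σ²-sortPair {u} {v} e with sortPair-either (u , v)
  ... | inj₁ eq = trans (cong σ² eq) (σ²-Adj e)
  ... | inj₂ eq = trans (cong σ² eq) (trans (σ²-Adj (adj-sym e)) (σ-sym e))

  walkSign-foldr : ∀ {u v} (w : Walk u v) →
                   walkSign w ≡ foldr _*_ + (List.map σ² (List.map sortPair (steps w)))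
  walkSign-foldr ε       = refl
  walkSign-foldr (e ◅ w) = cong₂ _*_ (sym (σ²-sortPair e)) (walkSign-foldr w)

  cycleSign-resp-≈ᶜ : ∀ C D → C ≈ᶜ D → cycleSign C ≡ cycleSign D
  cycleSign-resp-≈ᶜ C D C≈D = begin
    cycleSign C                                     ≡⟨ walkSign-foldr (walk C) ⟩
    foldr _*_ + (List.map σ² (edges graph C))
      ≡⟨ foldr-commMonoid (setoid Sign) *-isCommutativeMonoid (↭⇒↭ₛ (↭-map⁺ σ² (edges-↭ graph C D C≈D))) ⟩
    foldr _*_ + (List.map σ² (edges graph D))       ≡⟨ walkSign-foldr (walk D) ⟨
    cycleSign D                                     ∎

-- The action of automorphisms on cycles

inverse : ∀ {G} → Aut G → Aut G
inverse {G} φ = record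
  { perm      = Perm.flip perm
  ; preserves = λ e → reflects (subst₂ Adj (sym (inverseʳ perm)) (sym (inverseʳ perm)) e)
  ; reflects  = λ e → subst₂ Adj (inverseʳ perm) (inverseʳ perm) (preserves e)
  }
  where
  open Graph G
  open Iso φ

module _ {G : Graph} (φ : Aut G) where
  open Graph G
  open Iso φ

  fun-injective : ∀ {u v} → fun u ≡ fun v → u ≡ v
  fun-injective = Injection.injective (↔⇒↣ perm)

  steps-gmap : ∀ {u v} (w : Walk u v) →
               steps (gmap fun preserves w) ≡ List.map (Product.map fun fun) (steps w)
  steps-gmap ε       = refl
  steps-gmap (_ ◅ w) = cong (_ ∷_) (steps-gmap w)

  len-mapCycle : ∀ C → len (mapCycle φ C) ≡ len C
  len-mapCycle C = trans (cong length (steps-gmap (walk C))) (length-map _ (steps (walk C)))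

  HasEdge-mapCycle : ∀ C u v → HasEdge C u v ⇔ HasEdge (mapCycle φ C) (fun u) (fun v)
  HasEdge-mapCycle C u v = mk⇔ (Sum.map to to) (Sum.map from from)
    where
    to : ∀ {a b} → (a , b) ∈ steps (walk C) → (fun a , fun b) ∈ steps (walk (mapCycle φ C))
    to ab∈ = subst (_ ∈_) (sym (steps-gmap (walk C))) (∈-map⁺ _ ab∈)

    from : ∀ {a b} → (fun a , fun b) ∈ steps (walk (mapCycle φ C)) → (a , b) ∈ steps (walk C)
    from ab∈ with (c , d) , cd∈ , eq ← ∈-map⁻ (Product.map fun fun) (subst (_ ∈_) (steps-gmap (walk C)) ab∈)
      = subst (_∈ steps (walk C))
          (sym (cong₂ _,_ (fun-injective (cong proj₁ eq)) (fun-injective (cong proj₂ eq)))) cd∈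

  mapCycle-injective : ∀ C D → mapCycle φ C ≈ᶜ mapCycle φ D → C ≈ᶜ D
  mapCycle-injective C D φC≈φD u v =
    ⇔-sym (HasEdge-mapCycle D u v) ⇔-∘ (φC≈φD (fun u) (fun v) ⇔-∘ HasEdge-mapCycle C u v)

-- The two bases agree only propositionally, so the comparison is made on lists of steps, where no
-- transport of walks arises.
mapCycle-inverse : ∀ {G} (φ : Aut G) → let open Graph G in
                   ∀ C → mapCycle φ (mapCycle (inverse φ) C) ≈ᶜ C
mapCycle-inverse {G} φ C u v = mk⇔ (subst edge steps≡) (subst edge (sym steps≡))
  where
  open Graph G
  open Iso φ
  edge : List (V × V) → Set
  edge xs = (u , v) ∈ xs ⊎ (v , u) ∈ xs

  steps≡ : steps (walk (mapCycle φ (mapCycle (inverse φ) C))) ≡ steps (walk C)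
  steps≡ = begin
    steps (walk (mapCycle φ (mapCycle (inverse φ) C)))
      ≡⟨ steps-gmap φ (walk (mapCycle (inverse φ) C)) ⟩
    List.map (Product.map fun fun) (steps (walk (mapCycle (inverse φ) C)))
      ≡⟨ cong (List.map _) (steps-gmap (inverse φ) (walk C)) ⟩
    List.map (Product.map fun fun) (List.map (Product.map (perm ⟨$⟩ˡ_) (perm ⟨$⟩ˡ_)) (steps (walk C)))
      ≡⟨ map-∘ (steps (walk C)) ⟨
    List.map (λ p → Product.map fun fun (Product.map (perm ⟨$⟩ˡ_) (perm ⟨$⟩ˡ_) p)) (steps (walk C))
      ≡⟨ map-cong (λ _ → cong₂ _,_ (inverseʳ perm) (inverseʳ perm)) (steps (walk C)) ⟩
    List.map id (steps (walk C))
      ≡⟨ map-id (steps (walk C)) ⟩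
    steps (walk C) ∎

-- Images of signed cycle classes

≢⇒≡*- : ∀ s t → s ≢ t → s ≡ t * -
≢⇒≡*- + + s≢t = contradiction refl s≢t
≢⇒≡*- + - _   = refl
≢⇒≡*- - + _   = refl
≢⇒≡*- - - s≢t = contradiction refl s≢t

module _ (Γ : SignedGraph) (φ : Aut (SignedGraph.graph Γ)) where
  open SignedGraph Γ
  open Graph graph

  -- With only two signs, knowing which cycles are images of positive ones also determines the signs
  -- of the images of negative ones.
  scales⇔image : ∀ i t →
    (∀ C → 𝒞 i C → cycleSign (mapCycle φ C) ≡ t * cycleSign C) ⇔
    image φ (𝒞± i +) ≐ 𝒞± i t
  scales⇔image i t = mk⇔ to from
    where
    to : (∀ C → 𝒞 i C → cycleSign (mapCycle φ C) ≡ t * cycleSign C) →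
         image φ (𝒞± i +) ≐ 𝒞± i t
    to scales = (λ {C} → image⊆ {C}) , (λ {C} → image⊇ {C})
      where
      image⊆ : image φ (𝒞± i +) ⊆ 𝒞± i t
      image⊆ {C} (D , (D∈ , D+) , φD≈C) =
        trans (cong parity (trans (sym (len-resp-≈ᶜ graph (mapCycle φ D) C φD≈C)) (len-mapCycle φ D))) D∈ ,
        (begin
          cycleSign C               ≡⟨ cycleSign-resp-≈ᶜ Γ (mapCycle φ D) C φD≈C ⟨
          cycleSign (mapCycle φ D)  ≡⟨ scales D D∈ ⟩
          t * cycleSign D           ≡⟨ cong (t *_) D+ ⟩
          t * +                     ≡⟨ *-identityʳ t ⟩
          t                         ∎)

      image⊇ : 𝒞± i t ⊆ image φ (𝒞± i +)
      -- The preimage `D` of `C` under `φ` is positive: scaling its sign by `t` gives `t`, and `t`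
      -- cancels.
      image⊇ {C} (C∈ , Ct) = D , (D∈ , *-cancelˡ-≡ t _ _ (begin
          t * cycleSign D           ≡⟨ scales D D∈ ⟨
          cycleSign (mapCycle φ D)  ≡⟨ cycleSign-resp-≈ᶜ Γ (mapCycle φ D) C (mapCycle-inverse φ C) ⟩
          cycleSign C               ≡⟨ Ct ⟩
          t                         ≡⟨ *-identityʳ t ⟨
          t * +                     ∎)) , mapCycle-inverse φ C
        where
        D : Cycle
        D = mapCycle (inverse φ) C

        D∈ : 𝒞 i D
        D∈ = trans (cong parity (len-mapCycle (inverse φ) C)) C∈

    from : image φ (𝒞± i +) ≐ 𝒞± i t →
           ∀ C → 𝒞 i C → cycleSign (mapCycle φ C) ≡ t * cycleSign C
    from (image⊆ , image⊇) C C∈ with cycleSign C in C±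
    ... | + = trans (proj₂ (image⊆ {mapCycle φ C} (C , (C∈ , C±) , λ _ _ → mk⇔ id id))) (sym (*-identityʳ t))
    -- If the image of a negative `C` had sign `t`, it would also be the image of a positive `D`;
    -- injectivity on edge sets would give `D` and `C` the same sign.
    ... | - = ≢⇒≡*- _ t sign≢t
      where
      sign≢t : cycleSign (mapCycle φ C) ≢ t
      sign≢t φCt
        with D , (_ , D+) , φD≈φC ← image⊇ {mapCycle φ C} (trans (cong parity (len-mapCycle φ C)) C∈ , φCt)
        with () ← trans (sym D+) (trans (cycleSign-resp-≈ᶜ Γ D C (mapCycle-injective φ D C φD≈φC)) C±)

-- Balance

-- A base vertex exists only relative to some vertex, since the graph may be empty.
root : ∀ {n} → Fin n → Fin n
root {suc _} _ = zero

root-constant : ∀ {n} (u v : Fin n) → root u ≡ root v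
root-constant {suc _} _ _ = refl

module _ (Γ : SignedGraph) where
  open SignedGraph Γ
  open Graph graph

  Balanced : Set
  Balanced = ∀ C → cycleSign C ≡ +

  IsPotential : (V → Sign) → Set
  IsPotential s = ∀ u v (e : Adj u v) → σ e ≡ s u * s v

  walkSign-◅◅ : ∀ {u v x} (p : Walk u v) (q : Walk v x) →
                walkSign (p ◅◅ q) ≡ walkSign p * walkSign q
  walkSign-◅◅ ε       q = refl
  walkSign-◅◅ (e ◅ p) q = trans (cong (σ e *_) (walkSign-◅◅ p q)) (sym (*-assoc (σ e) _ _))

  -- The product telescopes: the value of `s` at each intermediate vertex occurs twice.
  potential-walkSign : ∀ s → IsPotential s → ∀ {u v} (w : Walk u v) → walkSign w ≡ s u * s v
  potential-walkSign s _ {u} ε = sym (s*s≡+ (s u))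
  potential-walkSign s pot {u} {v} (_◅_ {j = x} e w) = begin
    σ e * walkSign w           ≡⟨ cong₂ _*_ (pot u x e) (potential-walkSign s pot w) ⟩
    s u * s x * (s x * s v)    ≡⟨ *-assoc (s u) (s x) _ ⟩
    s u * (s x * (s x * s v))  ≡⟨ cong (s u *_) (*-assoc (s x) (s x) (s v)) ⟨
    s u * (s x * s x * s v)    ≡⟨ cong (λ t → s u * (t * s v)) (s*s≡+ (s x)) ⟩
    s u * s v                  ∎

  module _ (balanced : Balanced) where

    -- Sorted by length: a single step would be a loop, two steps run back and forth along one edge,
    -- and three or more steps form a cycle.
    unique-closed-walkSign : ∀ {u} (w : Walk u u) → Unique (starts graph w) → walkSign w ≡ +
    unique-closed-walkSign ε _ = refl
    unique-closed-walkSign (e ◅ ε) _ = contradiction e (adj-irrefl refl)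
    unique-closed-walkSign (e ◅ e′ ◅ ε) _ = begin
      σ e * (σ e′ * +)   ≡⟨ cong (σ e *_) (*-identityʳ (σ e′)) ⟩
      σ e * σ e′         ≡⟨ cong (λ x → σ e * σ x) (adj-irrelevant e′ (adj-sym e)) ⟩
      σ e * σ (adj-sym e)  ≡⟨ cong (σ e *_) (σ-sym e) ⟩
      σ e * σ e          ≡⟨ s*s≡+ (σ e) ⟩
      +                  ∎
    unique-closed-walkSign w@(_ ◅ _ ◅ _ ◅ _) w! = balanced record
      { base = _ ; walk = w ; long = s≤s (s≤s (s≤s z≤n)) ; distinct = w! }

    -- `starts` omits the final vertex, so `v` is added to list all vertices of the walk.
    IsPath : ∀ {u v} → Walk u v → Set
    IsPath {v = v} w = Unique (v ∷ starts graph w)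

    -- `before⊆` carries the induction in `splitAt`: a vertex missing from the whole walk is missing
    -- from its initial part, which stays a path when that vertex is put in front.
    record SplitAt {u v} (w : Walk u v) (x : V) : Set where
      field
        before      : Walk u x
        after       : Walk x v
        sign-split  : walkSign w ≡ walkSign before * walkSign after
        before-path : IsPath before
        after-path  : IsPath after
        before⊆     : ∀ {y} → y ∈ starts graph before → y ∈ starts graph w

    splitAt : ∀ {u v x} (w : Walk u v) → IsPath w → x ∈ starts graph w → SplitAt w x
    splitAt w@(_ ◅ _) w! (here refl) = record
      { before = ε ; after = w ; sign-split = refl
      ; before-path = [] ∷ [] ; after-path = w! ; before⊆ = λ () }
    splitAt {u} (e ◅ w) ((v≢u ∷ v∉w) ∷ u∉w ∷ w!) (there x∈) = record
      { before      = e ◅ before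
      ; after       = after
      ; sign-split  = trans (cong (σ e *_) sign-split) (sym (*-assoc (σ e) _ _))
      ; before-path = before-path′ before-path
      ; after-path  = after-path
      ; before⊆     = λ { (here eq) → here eq ; (there y∈) → there (before⊆ y∈) }
      }
      where
      open SplitAt (splitAt w (v∉w ∷ w!) x∈)
      before-path′ : IsPath before → IsPath (e ◅ before)
      before-path′ (x∉ ∷ before!) =
        ((λ x≡u → All.lookup u∉w x∈ (sym x≡u)) ∷ x∉) ∷
        All.tabulate (λ y∈ → All.lookup u∉w (before⊆ y∈)) ∷ before!

    -- Loop erasure: each erased loop is a cycle, or an edge traversed back and forth.
    eraseLoops : ∀ {u v} (w : Walk u v) → Σ (Walk u v) λ p → IsPath p × walkSign w ≡ walkSign p
    eraseLoops ε = ε , [] ∷ [] , refl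
    eraseLoops {u} {v} (e ◅ w) with p , p!@(v∉p ∷ p-unique) , w≡p ← eraseLoops w
      with any? (u ≟_) (starts graph p)
    ... | yes u∈p = after , after-path , (begin
            σ e * walkSign w                          ≡⟨ cong (σ e *_) (trans w≡p sign-split) ⟩
            σ e * (walkSign before * walkSign after)  ≡⟨ *-assoc (σ e) _ _ ⟨
            σ e * walkSign before * walkSign after
              -- `before` ends at `u`, so its path condition is literally the distinctness of the
              -- starts of the loop `e ◅ before`.
              ≡⟨ cong (_* walkSign after) (unique-closed-walkSign (e ◅ before) before-path) ⟩
            walkSign after                            ∎)
      where open SplitAt (splitAt p p! u∈p)
    ... | no u∉p with u ≟ v
    ...   | no u≢v   = e ◅ p , ((u≢v ∘ sym) ∷ v∉p) ∷ ¬Any⇒All¬ _ u∉p ∷ p-unique , cong (σ e *_) w≡p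
    -- Here `u` is the final vertex of `p`, which `starts` does not see; the whole of `e ◅ p` is the
    -- loop to erase.
    ...   | yes refl = ε , [] ∷ [] , trans (cong (σ e *_) w≡p) (unique-closed-walkSign (e ◅ p) p!)

    -- Loop erasure leaves a path from `u` to `u`, which must be empty since a nonempty one would
    -- list `u` twice.
    closed-walkSign : ∀ {u} (w : Walk u u) → walkSign w ≡ +
    closed-walkSign w with eraseLoops w
    ... | ε     , _               , w≡ = w≡
    ... | _ ◅ _ , ((u≢u ∷ _) ∷ _) , _  = contradiction refl u≢u

    potential : V → Sign
    potential v = walkSign (connected (root v) v)

    -- Both (connected r u, e, connected v r) and (connected r v, connected v r) are closed walks.
    potential-isPotential : IsPotential potential
    potential-isPotential u v e = begin
      σ e                              ≡⟨ cong (_* σ e) (s*s≡+ (potential u)) ⟨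
      potential u * potential u * σ e  ≡⟨ *-assoc (potential u) _ _ ⟩
      potential u * (potential u * σ e) ≡⟨ cong (potential u *_) (along (root-constant v u)) ⟩
      potential u * potential v        ∎
      where
      r : V
      r = root u

      back : Walk v r
      back = connected v r

      -- The two roots are only propositionally equal, so their equality is passed in to compare
      -- `potential v` with a walk from `r`.
      along : root v ≡ root u → potential u * σ e ≡ potential v
      along rv≡ru = *-cancelʳ-≡ (walkSign back) _ _ (begin
        potential u * σ e * walkSign back            ≡⟨ *-assoc (potential u) _ _ ⟩
        potential u * walkSign (e ◅ back)            ≡⟨ walkSign-◅◅ (connected r u) (e ◅ back) ⟨
        walkSign (connected r u ◅◅ e ◅ back)         ≡⟨ closed-walkSign (connected r u ◅◅ e ◅ back) ⟩
        +                                            ≡⟨ closed-walkSign (connected r v ◅◅ back) ⟨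
        walkSign (connected r v ◅◅ back)             ≡⟨ walkSign-◅◅ (connected r v) back ⟩
        walkSign (connected r v) * walkSign back
          ≡⟨ cong (λ x → walkSign (connected x v) * walkSign back) rv≡ru ⟨
        potential v * walkSign back                  ∎)

  balanced⇔potential : Balanced ⇔ ∃ λ s → IsPotential s
  balanced⇔potential = mk⇔
    (λ balanced → potential balanced , potential-isPotential balanced)
    (λ (s , pot) C → trans (potential-walkSign s pot (walk C)) (s*s≡+ (s (base C))))

-- The twisted signature and sign arithmetic

twist : (Γ : SignedGraph) → Aut (SignedGraph.graph Γ) → SignedGraph
twist Γ φ = record
  { graph     = graph
  ; connected = connected
  ; σ         = λ e → σ e * opposite (σ (preserves e))
  ; σ-sym     = λ e → cong₂ (λ s t → s * opposite t) (σ-sym e)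
      (trans (cong σ (adj-irrelevant (preserves (adj-sym e)) (adj-sym (preserves e)))) (σ-sym (preserves e)))
  }
  where
  open SignedGraph Γ
  open Graph graph
  open Iso φ

toSign-parity-suc : ∀ n → toSign (parity (suc n)) ≡ opposite (toSign (parity n))
toSign-parity-suc n =
  trans (cong toSign (sym (⁻¹-selfInverse (suc-homo-⁻¹ n)))) (⁻¹-homo-opposite (parity n))

sign : Bool → Sign
sign false = +
sign true  = -

isNegative : Sign → Bool
isNegative + = false
isNegative - = true

sign-isNegative : ∀ s → sign (isNegative s) ≡ s
sign-isNegative + = refl
sign-isNegative - = refl

-- For an edge `e` with image `φ e`: `s` and `t` are their signs, and `a`, `b` record whether the
-- ends of `φ e` lie in `U`. Preserving the sign of `e` into the switching of the negated graph then
-- amounts to the potential equation for `twist`.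
switched⇔ : ∀ a b s t →
  ((if a xor b then opposite (opposite t) else opposite t) ≡ s) ⇔ (s * opposite t ≡ sign a * sign b)
switched⇔ a b s t = mk⇔ (to a b s t) (from a b s t)
  where
  to : ∀ a b s t → (if a xor b then opposite (opposite t) else opposite t) ≡ s →
       s * opposite t ≡ sign a * sign b
  to false false _ + refl = refl
  to false false _ - refl = refl
  to false true  _ + refl = refl
  to false true  _ - refl = refl
  to true  false _ + refl = refl
  to true  false _ - refl = refl
  to true  true  _ + refl = refl
  to true  true  _ - refl = refl

  from : ∀ a b s t → s * opposite t ≡ sign a * sign b →
         (if a xor b then opposite (opposite t) else opposite t) ≡ s
  from false false - - ()
  from false false - + _ = refl
  from false false + - _ = refl
  from false false + + ()
  from false true  - - _ = refl
  from false true  - + ()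
  from false true  + - ()
  from false true  + + _ = refl
  from true  false - - _ = refl
  from true  false - + ()
  from true  false + - ()
  from true  false + + _ = refl
  from true  true  - - ()
  from true  true  - + _ = refl
  from true  true  + - _ = refl
  from true  true  + + ()

-- Sign-symmetry, potentials and weak automorphisms

module _ (Γ : SignedGraph) where
  open SignedGraph Γ
  open Graph graph

  signSymmetric⇔potential : SignSymmetric Γ ⇔
    ∃ λ (φ : Aut graph) → ∃ λ s → IsPotential (twist Γ φ) s
  signSymmetric⇔potential = mk⇔ to from
    where
    to : SignSymmetric Γ → ∃ λ φ → ∃ λ s → IsPotential (twist Γ φ) s
    to (U , Γ≅) = iso , (λ v → sign (lookup U (Iso.fun iso v))) ,
      λ u v e → Equivalence.to (switched⇔ (lookup U (Iso.fun iso u)) _ _ _) (preserves-σ e)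
      where open SignedIso Γ≅

    from : (∃ λ φ → ∃ λ s → IsPotential (twist Γ φ) s) → SignSymmetric Γ
    from (φ , s , pot) = U , record
      { iso         = φ
      ; preserves-σ = λ {u} {v} e → Equivalence.from (switched⇔ (lookup U (fun u)) (lookup U (fun v)) _ _)
          (trans (pot u v e) (sym (cong₂ _*_ (sign-U u) (sign-U v))))
      }
      where
      open Iso φ
      U : Subset order
      -- Switching happens in the target of `φ` while `s` lives on the source, hence the inverse
      -- permutation.
      U = tabulate (λ v → isNegative (s (perm ⟨$⟩ˡ v)))

      sign-U : ∀ v → sign (lookup U (fun v)) ≡ s v
      sign-U v = begin
        sign (lookup U (fun v))                        ≡⟨ cong sign (lookup∘tabulate _ (fun v)) ⟩
        sign (isNegative (s (perm ⟨$⟩ˡ fun v)))         ≡⟨ sign-isNegative _ ⟩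
        s (perm ⟨$⟩ˡ fun v)                             ≡⟨ cong s (inverseˡ perm) ⟩
        s v                                            ∎

  module _ (φ : Aut graph) where
    open Iso φ

    -- Each edge contributes `opposite b * b`, that is `-`, whence the parity of the length. Keeping
    -- the image sign on the left lets it be cancelled later.
    twist-walkSign : ∀ {u v} (w : Walk u v) →
      SignedGraph.walkSign (twist Γ φ) w * walkSign (gmap fun preserves w) ≡
      toSign (parity (length (steps w))) * walkSign w
    twist-walkSign ε       = refl
    twist-walkSign (e ◅ w) = begin
      a * opposite b * T * (b * M)    ≡⟨ swap-middle (a * opposite b) T b M ⟩
      a * opposite b * b * (T * M)    ≡⟨ cong₂ _*_ (*-assoc a (opposite b) b) (twist-walkSign w) ⟩
      a * (opposite b * b) * (t * W)  ≡⟨ cong (λ x → a * x * (t * W)) (opposite[s]*s≡- b) ⟩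
      a * - * (t * W)                 ≡⟨ cong (_* (t * W)) (*-comm a -) ⟩
      - * a * (t * W)                 ≡⟨ swap-middle - a t W ⟩
      - * t * (a * W)                 ≡⟨ cong (_* (a * W)) (toSign-parity-suc (length (steps w))) ⟨
      toSign (parity (suc (length (steps w)))) * (a * W)  ∎
      where
      swap-middle : ∀ p q r s → p * q * (r * s) ≡ p * r * (q * s)
      swap-middle = interchange *-commutativeSemigroup
      a b t T M W : Sign
      a = σ e
      b = σ (preserves e)
      t = toSign (parity (length (steps w)))
      T = SignedGraph.walkSign (twist Γ φ) w
      M = walkSign (gmap fun preserves w)
      W = walkSign w

    balanced⇔weak : Balanced (twist Γ φ) ⇔ IsWeakAutomorphism Γ φ
    balanced⇔weak = mk⇔ to from
      where
      to : Balanced (twist Γ φ) → IsWeakAutomorphism Γ φ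
      to balanced = scales 1ℙ , scales 0ℙ
        where
        -- Multiplication by `toSign 1ℙ` computes to `opposite` and by `toSign 0ℙ` to the identity,
        -- so the two instances are the two halves of weakness.
        scales : ∀ i C → 𝒞 i C → cycleSign (mapCycle φ C) ≡ toSign i * cycleSign C
        scales _ C refl =
          trans (cong (_* cycleSign (mapCycle φ C)) (sym (balanced C))) (twist-walkSign (walk C))

      from : IsWeakAutomorphism Γ φ → Balanced (twist Γ φ)
      from (odd , even) C = *-cancelʳ-≡ (cycleSign (mapCycle φ C)) _ _
        (trans (twist-walkSign (walk C)) (sym scales))
        where
        scales : cycleSign (mapCycle φ C) ≡ toSign (parity (len C)) * cycleSign C
        scales with parity (len C) in C∈
        ... | 0ℙ = even C C∈
        ... | 1ℙ = odd C C∈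

theorem3p2 : (Γ : SignedGraph) → let open SignedGraph Γ in
    (SignSymmetric Γ ⇔ ∃ (λ (φ : Aut graph) → IsWeakAutomorphism Γ φ)) ×
    (∃ (λ (φ : Aut graph) → IsWeakAutomorphism Γ φ) ⇔
    ∃ (λ (φ : Aut graph) → image φ 𝒞₁⁺ ≐ 𝒞₁⁻ × image φ 𝒞₀⁺ ≐ 𝒞₀⁺))
theorem3p2 Γ =
  -- The automorphism is kept fixed; a potential for its twist is traded for balance, and balance
  -- for weakness.
  Σ-⇔ (↠-id _) (λ {φ} → balanced⇔weak Γ φ ⇔-∘ ⇔-sym (balanced⇔potential (twist Γ φ))) ⇔-∘ signSymmetric⇔potential Γ ,
  -- Odd cycles are scaled by `-` and even cycles by `+`, again for the same `φ`.
  Σ-⇔ (↠-id _) λ {φ} → scales⇔image Γ φ 1ℙ - ×-⇔ scales⇔image Γ φ 0ℙ +
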